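{- If the set of all Diophantine equations which have at most finitely many solutions in non-negative integers is recursively enumerable, then there exists an algorithm which decides whether or not a given Diophantine equation has a solution in non-negative integers.
   Context: A Diophantine equation is an equation $D(x_1,\ldots,x_p)=0$ with $D \in \mathbb{Z}[x_1,\ldots,x_p]$. -}

module Defs where

open import Data.Nat using (ℕ)
open import Data.Integer using (ℤ; +_; _+_; _*_)
open import Data.Fin using (Fin)
open import Data.Vec using (Vec; lookup)
open import Data.List using (List)
open import Data.List.Membership.Propositional using (_∈_)
open import Data.Maybe using (Maybe; just)
open import Data.Bool using (Bool; true; false)
open import Data.Product using (Σ; ∃; _×_; _,_)
open import Relation.Binary.PropositionalEquality using (_≡_)
open import Relation.Nullary using (¬_)

-- Polynomials in ℤ[x₀,…,x_{p-1}], given as (unnormalised) expressions.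
-- Every polynomial with integer coefficients is denoted by some expression.
data Poly (p : ℕ) : Set where
  const : ℤ → Poly p
  var   : Fin p → Poly p
  _⊕_   : Poly p → Poly p → Poly p
  _⊗_   : Poly p → Poly p → Poly p

⟦_⟧ : ∀ {p} → Poly p → Vec ℕ p → ℤ
⟦ const c ⟧ x = c
⟦ var i   ⟧ x = + (lookup x i)
⟦ P ⊕ Q   ⟧ x = ⟦ P ⟧ x + ⟦ Q ⟧ x
⟦ P ⊗ Q   ⟧ x = ⟦ P ⟧ x * ⟦ Q ⟧ x

DiophEq : Set
DiophEq = Σ ℕ Poly

IsSolution : (p : ℕ) → Poly p → Vec ℕ p → Set
IsSolution p D x = ⟦ D ⟧ x ≡ + 0

HasSolution : DiophEq → Set
HasSolution (p , D) = ∃ λ x → IsSolution p D x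

FinitelyManySolutions : DiophEq → Set
FinitelyManySolutions (p , D) =
  ∃ λ (L : List (Vec ℕ p)) → ∀ x → IsSolution p D x → x ∈ L

-- A set of Diophantine equations is recursively enumerable (synthetically):
-- it is the range of an (Agda-definable, hence computable) enumeration,
-- where `nothing` means "no output at this stage" (allows the empty set).
IsEnumeratorOf : (ℕ → Maybe DiophEq) → (DiophEq → Set) → Set
IsEnumeratorOf f S = ∀ E → (S E → ∃ λ n → f n ≡ just E) × ((∃ λ n → f n ≡ just E) → S E)

-- An algorithm deciding a predicate, presented as a step-indexed procedure
-- d E n  (run d on input E for n steps; `nothing` = not yet halted) that
-- halts on every input and is correct whenever it halts.
Decides : (DiophEq → ℕ → Maybe Bool) → (DiophEq → Set) → Set
Decides d P =
  (∀ E → ¬ ¬ (∃ λ n → ∃ λ b → d E n ≡ just b))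
  × (∀ E n → d E n ≡ just true → P E)
  × (∀ E n → d E n ≡ just false → ¬ P E)

{-# OPTIONS --safe #-}
module Submission where

-- Adding a dummy variable to D gives an equation D′ whose solutions are the
-- (k , x) with x a solution of D, for every k. So D′ has finitely many
-- solutions iff D has none, and D is decided by searching, in parallel, for a
-- solution of D and for D′ in the enumeration of the finitely-solvable
-- equations. Exactly one of the two searches succeeds; which one cannot be
-- known in advance, hence halting holds only up to double negation.

open import Defs
open import Data.Nat using (ℕ; suc; _≤_; s≤s)
import Data.Nat as ℕ
open import Data.Nat.Properties using (≤-trans; m≤m+n; m≤n+m; n≮n)
open import Data.Integer using (+_)
import Data.Integer as ℤ
import Data.Fin as Fin
open import Data.Vec using (Vec; []; _∷_; head; sum)
open import Data.Vec.Relation.Unary.All as All using (All; []; _∷_)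
open import Data.List as List using (List; []; _∷_; [_]; upTo; cartesianProductWith)
open import Data.Nat.ListAction using () renaming (sum to sumᴸ)
open import Data.List.Relation.Unary.Any using (here; there; any?; satisfied)
open import Data.List.Membership.Propositional using (_∈_; lose)
open import Data.List.Membership.Propositional.Properties
  using (∈-cartesianProductWith⁺; ∈-upTo⁺)
open import Data.Maybe using (Maybe; just; nothing)
import Data.Maybe.Properties as Maybe
import Data.Product.Properties as Product
open import Data.Bool using (Bool; true; false)
open import Data.Product using (Σ; ∃; _,_; proj₁; proj₂)
open import Function using (_∘_)
open import Data.Empty using (⊥-elim)
open import Data.Sum using (_⊎_; inj₁; inj₂)
open import Relation.Binary.Definitions using (DecidableEquality)
open import Relation.Nullary using (¬_; Dec; yes; no; map′; _×-dec_)
open import Relation.Binary.PropositionalEquality using (_≡_; refl; cong; cong₂; sym; trans)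

infix 4 _≟_

_≟_ : ∀ {p} → DecidableEquality (Poly p)
const a ≟ const b = map′ (cong const) (λ { refl → refl }) (a ℤ.≟ b)
var i   ≟ var j   = map′ (cong var) (λ { refl → refl }) (i Fin.≟ j)
P ⊕ Q   ≟ R ⊕ S   =
  map′ (λ (P≡R , Q≡S) → cong₂ _⊕_ P≡R Q≡S) (λ { refl → refl , refl }) (P ≟ R ×-dec Q ≟ S)
P ⊗ Q   ≟ R ⊗ S   =
  map′ (λ (P≡R , Q≡S) → cong₂ _⊗_ P≡R Q≡S) (λ { refl → refl , refl }) (P ≟ R ×-dec Q ≟ S)
const _ ≟ var _   = no λ ()
const _ ≟ _ ⊕ _   = no λ ()
const _ ≟ _ ⊗ _   = no λ ()
var _   ≟ const _ = no λ ()
var _   ≟ _ ⊕ _   = no λ ()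
var _   ≟ _ ⊗ _   = no λ ()
_ ⊕ _   ≟ const _ = no λ ()
_ ⊕ _   ≟ var _   = no λ ()
_ ⊕ _   ≟ _ ⊗ _   = no λ ()
_ ⊗ _   ≟ const _ = no λ ()
_ ⊗ _   ≟ var _   = no λ ()
_ ⊗ _   ≟ _ ⊕ _   = no λ ()

_≟-DiophEq_ : DecidableEquality DiophEq
_≟-DiophEq_ = Product.≡-dec ℕ._≟_ _≟_

isSolution? : ∀ p (D : Poly p) x → Dec (IsSolution p D x)
isSolution? p D x = ⟦ D ⟧ x ℤ.≟ + 0

weaken : ∀ {p} → Poly p → Poly (suc p)
weaken (const c) = const c
weaken (var i)   = var (Fin.suc i)
weaken (P ⊕ Q)   = weaken P ⊕ weaken Q
weaken (P ⊗ Q)   = weaken P ⊗ weaken Q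

⟦weaken⟧ : ∀ {p} (P : Poly p) k x → ⟦ weaken P ⟧ (k ∷ x) ≡ ⟦ P ⟧ x
⟦weaken⟧ (const c) k x = refl
⟦weaken⟧ (var i)   k x = refl
⟦weaken⟧ (P ⊕ Q)   k x = cong₂ ℤ._+_ (⟦weaken⟧ P k x) (⟦weaken⟧ Q k x)
⟦weaken⟧ (P ⊗ Q)   k x = cong₂ ℤ._*_ (⟦weaken⟧ P k x) (⟦weaken⟧ Q k x)

addDummyVariable : DiophEq → DiophEq
addDummyVariable (p , D) = suc p , weaken D

¬HasSolution⇒finite-addDummyVariable :
  ∀ E → ¬ HasSolution E → FinitelyManySolutions (addDummyVariable E)
¬HasSolution⇒finite-addDummyVariable (p , D) noSol =
  [] , λ { (k ∷ x) sol → ⊥-elim (noSol (x , trans (sym (⟦weaken⟧ D k x)) sol)) }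

head≤sum-of-heads : ∀ {p} (xs : List (Vec ℕ (suc p))) {k x} → (k ∷ x) ∈ xs →
                    k ≤ sumᴸ (List.map head xs)
head≤sum-of-heads (_ ∷ ys) (here refl) = m≤m+n _ _
head≤sum-of-heads (y ∷ ys) (there k∷x∈ys) =
  ≤-trans (head≤sum-of-heads ys k∷x∈ys) (m≤n+m _ (head y))

-- A list of solutions of the weakened equation is escaped by choosing the
-- dummy coordinate larger than the sum of all first coordinates in the list.
finite-addDummyVariable⇒¬HasSolution :
  ∀ E → FinitelyManySolutions (addDummyVariable E) → ¬ HasSolution E
finite-addDummyVariable⇒¬HasSolution (p , D) (xs , complete) (x , sol) =
  n≮n bound (head≤sum-of-heads xs (complete (suc bound ∷ x) (trans (⟦weaken⟧ D _ x) sol)))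
  where
  bound : ℕ
  bound = sumᴸ (List.map head xs)

box : ∀ p → ℕ → List (Vec ℕ p)
box ℕ.zero n = [ [] ]
box (suc p) n = cartesianProductWith _∷_ (upTo (suc n)) (box p n)

∈-box : ∀ {p n} {x : Vec ℕ p} → All (_≤ n) x → x ∈ box p n
∈-box []          = here refl
∈-box (k≤n ∷ x≤n) = ∈-cartesianProductWith⁺ _∷_ (∈-upTo⁺ (s≤s k≤n)) (∈-box x≤n)

entries≤sum : ∀ {p} (x : Vec ℕ p) → All (_≤ sum x) x
entries≤sum []      = []
entries≤sum (k ∷ x) =
  m≤m+n k (sum x) ∷ All.map (λ i≤sum → ≤-trans i≤sum (m≤n+m (sum x) k)) (entries≤sum x)

∈-box-sum : ∀ {p} (x : Vec ℕ p) → x ∈ box p (sum x)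
∈-box-sum x = ∈-box (entries≤sum x)

verdict : ∀ {A B : Set} → Dec A → Dec B → Maybe Bool
verdict (yes _) _       = just true
verdict (no _)  (yes _) = just false
verdict (no _)  (no _)  = nothing

verdict-true : ∀ {A B : Set} (a? : Dec A) (b? : Dec B) → verdict a? b? ≡ just true → A
verdict-true (yes a) _       _  = a
verdict-true (no _)  (yes _) ()
verdict-true (no _)  (no _)  ()

verdict-false : ∀ {A B : Set} (a? : Dec A) (b? : Dec B) → verdict a? b? ≡ just false → B
verdict-false (yes _) _       ()
verdict-false (no _)  (yes b) _  = b
verdict-false (no _)  (no _)  ()

verdict-halts : ∀ {A B : Set} (a? : Dec A) (b? : Dec B) → A ⊎ B → ∃ λ v → verdict a? b? ≡ just v
verdict-halts (yes _) _       _        = true , refl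
verdict-halts (no _)  (yes _) _        = false , refl
verdict-halts (no ¬a) (no _)  (inj₁ a) = ⊥-elim (¬a a)
verdict-halts (no _)  (no ¬b) (inj₂ b) = ⊥-elim (¬b b)

decide : (ℕ → Maybe DiophEq) → DiophEq → ℕ → Maybe Bool
decide f E@(p , D) n =
  verdict (any? (isSolution? p D) (box p n))
          (Maybe.≡-dec _≟-DiophEq_ (f n) (just (addDummyVariable E)))

theorem12 : (f : ℕ → Maybe DiophEq) → IsEnumeratorOf f FinitelyManySolutions →
    Σ (DiophEq → ℕ → Maybe Bool) (λ d → Decides d HasSolution)
theorem12 f enumerates = decide f , halts , sound-true , sound-false
  where
  halts : ∀ E → ¬ ¬ (∃ λ n → ∃ λ b → decide f E n ≡ just b)
  halts E neverHalts = neverHalts (n , verdict-halts _ _ (inj₂ fn≡E′))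
    where
    noSolution : ¬ HasSolution E
    noSolution (x , sol) =
      neverHalts (sum x , verdict-halts _ _ (inj₁ (lose (∈-box-sum x) sol)))
    enumerated : ∃ λ n → f n ≡ just (addDummyVariable E)
    enumerated = proj₁ (enumerates (addDummyVariable E))
                   (¬HasSolution⇒finite-addDummyVariable E noSolution)
    n : ℕ
    n = proj₁ enumerated
    fn≡E′ : f n ≡ just (addDummyVariable E)
    fn≡E′ = proj₂ enumerated

  sound-true : ∀ E n → decide f E n ≡ just true → HasSolution E
  sound-true E n = satisfied ∘ verdict-true _ _

  sound-false : ∀ E n → decide f E n ≡ just false → ¬ HasSolution E
  sound-false E n =
    finite-addDummyVariable⇒¬HasSolution E ∘ proj₂ (enumerates (addDummyVariable E)) ∘ (n ,_)
    ∘ verdict-false _ _
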